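{- Let $G$ be a connected cograph. Then $G$ is monopolar nearly split if and only if $G$ contains none of the following as an induced subgraph: $R_1 = 2K_1 \oplus 2K_1 \oplus 2K_1$; $R_2 = 2K_2 \oplus (K_2 \cup K_1)$; $R_3 = 2K_1 \oplus (P_3 \cup K_2)$; $R_4 = K_1 \oplus (2K_1 \oplus 2K_2)$; $R_5 = K_2 \oplus 2K_3$; $R_6 = K_1 \oplus (P_3 \cup 2K_3)$; $R_7 = K_1 \oplus (K_3 \cup (P_3 \oplus K_1))$; $R_8 = K_1 \oplus (K_3 \cup (K_1 \oplus (K_1 \cup K_2)))$.
   Context: Graphs are finite and simple. A cograph is a graph with no induced $P_4$. A graph $G=(V,E)$ is monopolar if there is a partition $\{A,B\}$ of $V$ such that $G[A]$ is a disjoint union of cliques with no edges between them and $B$ is an independent set. A graph is $(1,2)$-partitionable if its vertex set can be partitioned into at most one clique and at most two independent sets. A graph is monopolar nearly split if it is monopolar or $(1,2)$-partitionable. $K_n$, $P_n$ denote the complete graph and path on $n$ vertices; $G\cup H$ is the disjoint union and $kG$ the disjoint union of $k$ copies of $G$; $G\oplus H$ is the join (disjoint union plus all edges between the two parts), with $A\oplus B\oplus C=(A\oplus B)\oplus C$. -}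

module Defs where

open import Data.Nat using (ℕ; zero; suc; _+_; _≡ᵇ_)
open import Data.Fin using (Fin; toℕ; splitAt; _≟_)
open import Data.Bool using (Bool; true; false; not; _∨_)
open import Data.Bool.Properties using (∨-comm)
open import Data.Sum using (_⊎_; inj₁; inj₂)
open import Data.Product using (Σ; ∃; _×_; _,_)
open import Data.Empty using (⊥)
open import Relation.Nullary using (¬_; does; yes; no)
open import Relation.Binary.PropositionalEquality using (_≡_; refl; sym; _≢_)
open import Function.Definitions using (Injective)

record Graph (n : ℕ) : Set where
  field
    adj    : Fin n → Fin n → Bool
    adj-sym    : ∀ i j → adj i j ≡ adj j i
    adj-irrefl : ∀ i → adj i i ≡ false
open Graph public

Adj : ∀ {n} → Graph n → Fin n → Fin n → Set
Adj G i j = adj G i j ≡ true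

InducedSub : ∀ {m n} → Graph m → Graph n → Set
InducedSub {m} {n} H G =
  Σ (Fin m → Fin n) λ f → Injective _≡_ _≡_ f × (∀ i j → adj H i j ≡ adj G (f i) (f j))

data Reachable {n} (G : Graph n) : Fin n → Fin n → Set where
  here : ∀ {u} → Reachable G u u
  step : ∀ {u v w} → Adj G u v → Reachable G v w → Reachable G u w

Connected : ∀ {n} → Graph n → Set
Connected {n} G = ∀ (u v : Fin n) → Reachable G u v

private
  ≡ᵇ-suc : ∀ x → (suc x ≡ᵇ x) ≡ false
  ≡ᵇ-suc zero = refl
  ≡ᵇ-suc (suc x) = ≡ᵇ-suc x

  neq : ∀ {n} → Fin n → Fin n → Bool
  neq i j = not (does (i ≟ j))

  neq-sym : ∀ {n} (i j : Fin n) → neq i j ≡ neq j i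
  neq-sym i j with i ≟ j | j ≟ i
  ... | yes _ | yes _ = refl
  ... | no _  | no _  = refl
  ... | yes p | no q  = Data.Empty.⊥-elim (q (sym p))
    where import Data.Empty
  ... | no p  | yes q = Data.Empty.⊥-elim (p (sym q))
    where import Data.Empty

  neq-irr : ∀ {n} (i : Fin n) → neq i i ≡ false
  neq-irr i with i ≟ i
  ... | yes _ = refl
  ... | no p  = Data.Empty.⊥-elim (p refl)
    where import Data.Empty

K : (n : ℕ) → Graph n
K n = record { adj = neq ; adj-sym = neq-sym ; adj-irrefl = neq-irr }

P : (n : ℕ) → Graph n
P n = record
  { adj = λ i j → (suc (toℕ i) ≡ᵇ toℕ j) ∨ (suc (toℕ j) ≡ᵇ toℕ i)
  ; adj-sym = λ i j → ∨-comm (suc (toℕ i) ≡ᵇ toℕ j) (suc (toℕ j) ≡ᵇ toℕ i)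
  ; adj-irrefl = λ i → irr (toℕ i)
  }
  where
  irr : ∀ x → ((suc x ≡ᵇ x) ∨ (suc x ≡ᵇ x)) ≡ false
  irr x rewrite ≡ᵇ-suc x = refl

private
  sadj : ∀ {m n} → Graph m → Graph n → Bool → Fin m ⊎ Fin n → Fin m ⊎ Fin n → Bool
  sadj G H b (inj₁ i) (inj₁ j) = adj G i j
  sadj G H b (inj₂ i) (inj₂ j) = adj H i j
  sadj G H b (inj₁ _) (inj₂ _) = b
  sadj G H b (inj₂ _) (inj₁ _) = b

  sadj-sym : ∀ {m n} (G : Graph m) (H : Graph n) b x y → sadj G H b x y ≡ sadj G H b y x
  sadj-sym G H b (inj₁ i) (inj₁ j) = adj-sym G i j
  sadj-sym G H b (inj₂ i) (inj₂ j) = adj-sym H i j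
  sadj-sym G H b (inj₁ _) (inj₂ _) = refl
  sadj-sym G H b (inj₂ _) (inj₁ _) = refl

  sadj-irr : ∀ {m n} (G : Graph m) (H : Graph n) b x → sadj G H b x x ≡ false
  sadj-irr G H b (inj₁ i) = adj-irrefl G i
  sadj-irr G H b (inj₂ i) = adj-irrefl H i

  combine : ∀ {m n} → Graph m → Graph n → Bool → Graph (m + n)
  combine {m} G H b = record
    { adj = λ i j → sadj G H b (splitAt m i) (splitAt m j)
    ; adj-sym = λ i j → sadj-sym G H b (splitAt m i) (splitAt m j)
    ; adj-irrefl = λ i → sadj-irr G H b (splitAt m i)
    }

_∪_ : ∀ {m n} → Graph m → Graph n → Graph (m + n)
G ∪ H = combine G H false

_⊕_ : ∀ {m n} → Graph m → Graph n → Graph (m + n)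
G ⊕ H = combine G H true

infixl 6 _⊕_
infixl 7 _∪_

2×_ : ∀ {n} → Graph n → Graph (n + n)
2× G = G ∪ G

Cograph : ∀ {n} → Graph n → Set
Cograph G = ¬ InducedSub (P 4) G

-- partition {A,B}: side v ≡ true means v ∈ A.  G[A] is a disjoint union of
-- cliques (with no edges between them): witnessed by a clique label c,
-- distinct vertices of A being adjacent iff they have the same label.
-- B is independent.
Monopolar : ∀ {n} → Graph n → Set
Monopolar {n} G =
  Σ (Fin n → Bool) λ side →
  Σ (Fin n → Fin n) λ c →
    (∀ u v → side u ≡ true → side v ≡ true → u ≢ v → (Adj G u v → c u ≡ c v) × (c u ≡ c v → Adj G u v))
  × (∀ u v → side u ≡ false → side v ≡ false → adj G u v ≡ false)

-- partition into at most one clique (label zero) and at most two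
-- independent sets (labels 1 and 2); parts may be empty.
OneTwoPartitionable : ∀ {n} → Graph n → Set
OneTwoPartitionable {n} G =
  Σ (Fin n → Fin 3) λ lab →
    (∀ u v → lab u ≡ Fin.zero → lab v ≡ Fin.zero → u ≢ v → Adj G u v)
  × (∀ u v → lab u ≢ Fin.zero → lab u ≡ lab v → adj G u v ≡ false)
  where import Data.Fin as Fin

MonopolarNearlySplit : ∀ {n} → Graph n → Set
MonopolarNearlySplit G = Monopolar G ⊎ OneTwoPartitionable G

R1 = 2× K 1 ⊕ 2× K 1 ⊕ 2× K 1
R2 = 2× K 2 ⊕ (K 2 ∪ K 1)
R3 = 2× K 1 ⊕ (P 3 ∪ K 2)
R4 = K 1 ⊕ (2× K 1 ⊕ 2× K 2)
R5 = K 2 ⊕ 2× K 3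
R6 = K 1 ⊕ (P 3 ∪ 2× K 3)
R7 = K 1 ⊕ (K 3 ∪ (P 3 ⊕ K 1))
R8 = K 1 ⊕ (K 3 ∪ (K 1 ⊕ (K 1 ∪ K 2)))

{-# OPTIONS --safe #-}
module Submission where

-- For ⇐, a cograph is built up from single vertices by unions and joins (its cotree), and at a
-- connected root this is a join l ⊕ r.  If neither side is a clique, then without R1 both sides
-- are C₄-free, hence split unless one of them contains 2K₂; in that case R2, R3, R4 force the
-- other side to be independent and this one to be split or a disjoint union of cliques.  If l is a
-- clique, then without R1 and R4 the side r is (1,2)-partitionable unless it contains 2K₃; in that
-- case R5 makes l a single vertex and all obstructions together make r a disjoint union of cliques.
-- For ⇒, being monopolar and being (1,2)-partitionable are hereditary, no Rᵢ is monopolar, and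
-- each Rᵢ contains one of K_{2,2,2}, 2K₁ ⊕ 2K₂, 2K₃, which are not (1,2)-partitionable.

open import Defs
open import Data.Nat using (ℕ; _+_)
import Data.Nat.Properties as ℕ
open import Data.Fin using (Fin; zero; splitAt; join)
open import Data.Fin.Properties using (_≟_; all?; join-splitAt; ¬Fin0; pigeonhole; <⇒≢)
open import Data.Fin.Subset using (Subset)
open import Data.Fin.Subset.Properties using (anySubset?)
open import Data.Fin.Patterns
open import Data.Bool using (Bool; true; false; not)
import Data.Bool.Properties as Bool
open import Data.Empty using (⊥-elim)
open import Data.List using ([]; _∷_; allFin)
open import Data.List.Membership.Propositional using (_∈_)
open import Data.List.Membership.Propositional.Properties using (∈-allFin)
open import Data.List.Relation.Unary.All as All using ()
open import Data.List.Relation.Unary.Any using (here; there)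
open import Data.List.Relation.Unary.AllPairs using ([]; _∷_)
open import Data.List.Relation.Unary.Unique.Propositional using (Unique)
open import Data.List.Relation.Unary.Unique.Propositional.Properties using (allFin⁺)
open import Data.Product using (Σ; ∃; _×_; _,_; proj₁; proj₂)
open import Data.Sum using (_⊎_; inj₁; inj₂; [_,_]; swap)
import Data.Sum as Sum
open import Data.Vec using (Vec; []; _∷_; lookup; tabulate)
open import Data.Vec.Properties using (lookup∘tabulate; lookup-replicate)
open import Function using (_∘_; id)
open import Function.Bundles using (_⇔_; mk⇔)
open import Relation.Nullary using (¬_; Dec; yes; no; does)
open import Relation.Nullary.Decidable using (True; toWitness; ¬?; from-no; _×-dec_; _→-dec_; _⊎-dec_)
open import Relation.Binary.PropositionalEquality using (_≡_; _≢_; refl; sym; trans; cong)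

-- Induced copies given by explicit vertex lists

Induces : ∀ {m n} → Graph m → Graph n → Vec (Fin n) m → Set
Induces H K xs =
  ∀ i j → (lookup xs i ≡ lookup xs j → i ≡ j) × adj H i j ≡ adj K (lookup xs i) (lookup xs j)

induces? : ∀ {m n} (H : Graph m) (K : Graph n) xs → Dec (Induces H K xs)
induces? H K xs = all? λ i → all? λ j →
  ((lookup xs i ≟ lookup xs j) →-dec (i ≟ j)) ×-dec (adj H i j Bool.≟ adj K (lookup xs i) (lookup xs j))

-- Entry `i` of `xs` is the image of vertex `i` of `H`. The implicit `True` argument is solved by
-- evaluation, so every concrete list used below is verified during type checking.
induced : ∀ {m n} {H : Graph m} {K : Graph n} xs {_ : True (induces? H K xs)} → InducedSub H K
induced xs {t} =
  lookup xs , (λ {i} {j} → proj₁ (toWitness t i j)) , (λ i j → proj₂ (toWitness t i j))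

InducedSub-trans : ∀ {k m n} {F : Graph k} {H : Graph m} {G : Graph n} →
  InducedSub F H → InducedSub H G → InducedSub F G
InducedSub-trans (f , f-inj , f-adj) (g , g-inj , g-adj) =
  g ∘ f , f-inj ∘ g-inj , λ i j → trans (f-adj i j) (g-adj (f i) (f j))

C₄ = 2× K 1 ⊕ 2× K 1
diamond = P 3 ⊕ K 1
paw = K 1 ⊕ (K 1 ∪ K 2)

K-adj : ∀ {n} {i j : Fin n} → i ≢ j → adj (K n) i j ≡ true
K-adj {i = i} {j} ne with i ≟ j
... | yes e = ⊥-elim (ne e)
... | no _  = refl

glue : ∀ {m n} → Bool → Graph m → Graph n → Graph (m + n)
glue true  = _⊕_
glue false = _∪_

-- `sadj` is private, so its case table is restated; `adj-glue` shows that the two agree.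
glue-adj : ∀ {m n} → Graph m → Graph n → Bool → Fin m ⊎ Fin n → Fin m ⊎ Fin n → Bool
glue-adj H K b (inj₁ i) (inj₁ j) = adj H i j
glue-adj H K b (inj₂ i) (inj₂ j) = adj K i j
glue-adj H K b (inj₁ _) (inj₂ _) = b
glue-adj H K b (inj₂ _) (inj₁ _) = b

adj-glue : ∀ {m n} b (H : Graph m) (K : Graph n) i j →
  adj (glue b H K) i j ≡ glue-adj H K b (splitAt m i) (splitAt m j)
adj-glue {m} true H K i j with splitAt m i | splitAt m j
... | inj₁ _ | inj₁ _ = refl
... | inj₁ _ | inj₂ _ = refl
... | inj₂ _ | inj₁ _ = refl
... | inj₂ _ | inj₂ _ = refl
adj-glue {m} false H K i j with splitAt m i | splitAt m j
... | inj₁ _ | inj₁ _ = refl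
... | inj₁ _ | inj₂ _ = refl
... | inj₂ _ | inj₁ _ = refl
... | inj₂ _ | inj₂ _ = refl

splitAt-injective : ∀ m {n} {i j : Fin (m + n)} → splitAt m i ≡ splitAt m j → i ≡ j
splitAt-injective m {n} {i} {j} eq =
  trans (sym (join-splitAt m n i)) (trans (cong (join m n) eq) (join-splitAt m n j))

true≢false : ∀ {b} → b ≡ true → b ≢ false
true≢false refl ()

-- An entry of κ is true for a clique part and false for an independent part.
Mergeable : ∀ {k₁ k₂ k} → Bool → Vec Bool k₁ → Vec Bool k₂ → Vec Bool k →
  Vec (Fin k) k₁ → Vec (Fin k) k₂ → Set
Mergeable b κ₁ κ₂ κ g₁ g₂ =
    (∀ i → lookup κ (lookup g₁ i) ≡ lookup κ₁ i)
  × (∀ i → lookup κ (lookup g₂ i) ≡ lookup κ₂ i)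
  × (∀ i j → lookup g₁ i ≡ lookup g₁ j → i ≡ j)
  × (∀ i j → lookup g₂ i ≡ lookup g₂ j → i ≡ j)
  × (∀ i j → lookup g₁ i ≡ lookup g₂ j → lookup κ (lookup g₁ i) ≡ b)

mergeable? : ∀ {k₁ k₂ k} b (κ₁ : Vec Bool k₁) (κ₂ : Vec Bool k₂) (κ : Vec Bool k) g₁ g₂ →
  Dec (Mergeable b κ₁ κ₂ κ g₁ g₂)
mergeable? b κ₁ κ₂ κ g₁ g₂ =
        (all? λ i → lookup κ (lookup g₁ i) Bool.≟ lookup κ₁ i)
  ×-dec (all? λ i → lookup κ (lookup g₂ i) Bool.≟ lookup κ₂ i)
  ×-dec (all? λ i → all? λ j → (lookup g₁ i ≟ lookup g₁ j) →-dec (i ≟ j))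
  ×-dec (all? λ i → all? λ j → (lookup g₂ i ≟ lookup g₂ j) →-dec (i ≟ j))
  ×-dec (all? λ i → all? λ j → (lookup g₁ i ≟ lookup g₂ j) →-dec (lookup κ (lookup g₁ i) Bool.≟ b))

-- Vertex sets, their partitions, and disjoint unions of cliques

module VertexSets {N : ℕ} (G : Graph N) where

  infix 4 _⊆_ _⊑_
  infixl 5 _+ˢ_

  VSet : Set₁
  VSet = Fin N → Set

  _⊆_ : VSet → VSet → Set
  S ⊆ T = ∀ {v} → S v → T v

  _+ˢ_ : VSet → VSet → VSet
  (A +ˢ B) v = A v ⊎ B v

  record _⊑_ {m} (H : Graph m) (S : VSet) : Set where
    constructor emb
    field
      sub  : InducedSub H G
      mem  : ∀ i → S (proj₁ sub i)
  open _⊑_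

  Free : ∀ {m} → Graph m → VSet → Set
  Free H S = ¬ H ⊑ S

  ⊑-mono : ∀ {m} {H : Graph m} {S T} → S ⊆ T → H ⊑ S → H ⊑ T
  ⊑-mono s (emb f p) = emb f (s ∘ p)

  ⊑-sub : ∀ {m k} {F : Graph k} {H : Graph m} {S} → InducedSub F H → H ⊑ S → F ⊑ S
  ⊑-sub {F = F} {H} f (emb g p) = emb (InducedSub-trans {F = F} {H} {G} f g) (p ∘ proj₁ f)

  ⊑-induced : ∀ {m k} {F : Graph k} {H : Graph m} {S} xs {_ : True (induces? F H xs)} → H ⊑ S → F ⊑ S
  ⊑-induced {F = F} {H} xs {t} = ⊑-sub (induced {H = F} {H} xs {t})

  -- The Boolean lets unions and joins share their proofs. The clause `u ≢ v` records disjointness,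
  -- which non-adjacency alone would not give.
  Across : Bool → VSet → VSet → Set
  Across b A B = ∀ {u v} → A u → B v → u ≢ v × adj G u v ≡ b

  Across-sym : ∀ {b A B} → Across b A B → Across b B A
  Across-sym ac {u} {v} q p with ac p q
  ... | ne , e = ne ∘ sym , trans (adj-sym G u v) e

  -- Injectivity across the two sides rests on the disjointness in `Across`. Forbidden subgraphs
  -- below are assembled this way, with `⊑-induced` selecting or renumbering vertices where needed.
  ⊑-glue : ∀ {b A B m n} {H : Graph m} {K : Graph n} →
    Across b A B → H ⊑ A → K ⊑ B → glue b H K ⊑ (A +ˢ B)
  ⊑-glue {b} {A} {B} {m} {n} {H} {K} ac (emb (f , f-inj , f-adj) p) (emb (g , g-inj , g-adj) q) =
    emb (h ∘ splitAt m , splitAt-injective m ∘ h-inj _ _ ,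
         λ i j → trans (adj-glue b H K i j) (h-adj (splitAt m i) (splitAt m j)))
        (h-mem ∘ splitAt m)
    where
    h : Fin m ⊎ Fin n → Fin N
    h = [ f , g ]

    h-inj : ∀ x y → h x ≡ h y → x ≡ y
    h-inj (inj₁ i) (inj₁ j) e = cong inj₁ (f-inj e)
    h-inj (inj₁ i) (inj₂ j) e = ⊥-elim (proj₁ (ac (p i) (q j)) e)
    h-inj (inj₂ i) (inj₁ j) e = ⊥-elim (proj₁ (ac (p j) (q i)) (sym e))
    h-inj (inj₂ i) (inj₂ j) e = cong inj₂ (g-inj e)

    h-adj : ∀ x y → glue-adj H K b x y ≡ adj G (h x) (h y)
    h-adj (inj₁ i) (inj₁ j) = f-adj i j
    h-adj (inj₁ i) (inj₂ j) = sym (proj₂ (ac (p i) (q j)))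
    h-adj (inj₂ i) (inj₁ j) = sym (proj₂ (Across-sym ac (q i) (p j)))
    h-adj (inj₂ i) (inj₂ j) = g-adj i j

    h-mem : ∀ x → (A +ˢ B) (h x)
    h-mem (inj₁ i) = inj₁ (p i)
    h-mem (inj₂ j) = inj₂ (q j)

  -- Labels may depend on the membership proof, so that no decision of membership is ever needed.
  record Part {k} (κ : Vec Bool k) (S : VSet) : Set where
    constructor part
    field
      lab  : ∀ {v} → S v → Fin k
      homogeneous : ∀ {u v} (p : S u) (q : S v) → lab p ≡ lab q → u ≢ v → adj G u v ≡ lookup κ (lab p)
  open Part

  Empty Clique Indep Bipartite Split OneTwo : VSet → Set
  Empty     = Part []
  Clique    = Part (true ∷ [])
  Indep     = Part (false ∷ [])
  Bipartite = Part (false ∷ false ∷ [])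
  Split     = Part (true ∷ false ∷ [])
  OneTwo    = Part (true ∷ false ∷ false ∷ [])

  Part-mono : ∀ {k} {κ : Vec Bool k} {S T} → S ⊆ T → Part κ T → Part κ S
  Part-mono s (part l h) = part (l ∘ s) (λ p q → h (s p) (s q))

  -- The tables `g₁` and `g₂` place the old parts into the new ones. Parts from opposite sides may
  -- share a place only as two cliques across a join or two independent sets across a union; this is
  -- the last clause of `Mergeable`.
  merge : ∀ {b A B k₁ k₂ k} {κ₁ : Vec Bool k₁} {κ₂ : Vec Bool k₂} {κ : Vec Bool k} g₁ g₂
    {_ : True (mergeable? b κ₁ κ₂ κ g₁ g₂)} →
    Across b A B → Part κ₁ A → Part κ₂ B → Part κ (A +ˢ B)
  merge {b} {A} {B} {k = k} {κ = κ} g₁ g₂ {t} ac (part l₁ h₁) (part l₂ h₂) with toWitness t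
  ... | kind₁ , kind₂ , inj-g₁ , inj-g₂ , cross = part l h
    where
    l : ∀ {v} → (A +ˢ B) v → Fin k
    l (inj₁ p) = lookup g₁ (l₁ p)
    l (inj₂ q) = lookup g₂ (l₂ q)

    h : ∀ {u v} (p : (A +ˢ B) u) (q : (A +ˢ B) v) → l p ≡ l q → u ≢ v → adj G u v ≡ lookup κ (l p)
    h (inj₁ p) (inj₁ q) e ne = trans (h₁ p q (inj-g₁ _ _ e) ne) (sym (kind₁ _))
    h (inj₁ p) (inj₂ q) e ne = trans (proj₂ (ac p q)) (sym (cross _ _ e))
    h (inj₂ p) (inj₁ q) e ne =
      trans (proj₂ (Across-sym ac p q)) (sym (trans (cong (lookup κ) e) (cross _ _ (sym e))))
    h (inj₂ p) (inj₂ q) e ne = trans (h₂ p q (inj-g₂ _ _ e) ne) (sym (kind₂ _))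

  -- Cliques are labelled by vertices, as `Monopolar` asks. Since `rep∈` keeps labels inside `S`,
  -- disjoint sets have different labels, which `cluster-∪` relies on.
  record Cluster (S : VSet) : Set where
    constructor cluster
    field
      rep    : ∀ {v} → S v → Fin N
      rep∈   : ∀ {v} (p : S v) → S (rep p)
      rep-≡  : ∀ {u v} (p : S u) (q : S v) → Adj G u v → rep p ≡ rep q
      rep-Adj : ∀ {u v} (p : S u) (q : S v) → rep p ≡ rep q → u ≢ v → Adj G u v
  open Cluster

  -- Both inclusions occur: one carries members of `S` to `T`, the other brings their
  -- representatives back.
  Cluster-resp : ∀ {S T} → S ⊆ T → T ⊆ S → Cluster T → Cluster S
  Cluster-resp s t (cluster r r∈ a b) =
    cluster (r ∘ s) (t ∘ r∈ ∘ s) (λ p q → a (s p) (s q)) (λ p q → b (s p) (s q))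

  empty⇒cluster : ∀ {S} → Empty S → Cluster S
  empty⇒cluster (part l _) =
    cluster (λ p → ⊥-elim (¬Fin0 (l p))) (λ p → ⊥-elim (¬Fin0 (l p)))
            (λ p → ⊥-elim (¬Fin0 (l p))) (λ p → ⊥-elim (¬Fin0 (l p)))

  label-unique : ∀ (i j : Fin 1) → i ≡ j
  label-unique 0F 0F = refl

  clique-Adj : ∀ {S u v} → Clique S → S u → S v → u ≢ v → Adj G u v
  clique-Adj (part l h) p q ne =
    trans (h p q (label-unique _ _) ne) (cong (lookup (true ∷ [])) (label-unique (l p) 0F))

  indep-¬Adj : ∀ {S u v} → Indep S → S u → S v → adj G u v ≡ false
  indep-¬Adj {u = u} {v} (part l h) p q with u ≟ v
  ... | yes refl = adj-irrefl G u
  ... | no ne = trans (h p q (label-unique _ _) ne) (cong (lookup (false ∷ [])) (label-unique (l p) 0F))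

  clique⇒cluster : ∀ {S} → K 1 ⊑ S → Clique S → Cluster S
  clique⇒cluster (emb (f , _) m) c =
    cluster (λ _ → f 0F) (λ _ → m 0F) (λ _ _ _ → refl) (λ p q _ → clique-Adj c p q)

  indep⇒cluster : ∀ {S} → Indep S → Cluster S
  indep⇒cluster i =
    cluster (λ {v} _ → v) id (λ p q a → ⊥-elim (true≢false a (indep-¬Adj i p q))) (λ p q e ne → ⊥-elim (ne e))

  clique⇒2K₁-free : ∀ {S} → Clique S → Free (2× K 1) S
  clique⇒2K₁-free c (emb (f , inj , pres) m) =
    true≢false (clique-Adj c (m 0F) (m 1F) (λ e → 0≢1 (inj e))) (sym (pres 0F 1F))
    where
    0≢1 : _≢_ {A = Fin 2} 0F 1F
    0≢1 ()

  bipartite⇒K₃-free : ∀ {S} → Bipartite S → Free (K 3) S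
  -- Here `ℕ.≤-refl` proves `2 < 3`: two of the three vertices share one of the two classes.
  bipartite⇒K₃-free (part l h) (emb (f , inj , pres) m) with pigeonhole ℕ.≤-refl (l ∘ m)
  ... | i , j , i<j , e =
    true≢false (trans (sym (pres i j)) (K-adj (<⇒≢ i<j)))
      (trans (h (m i) (m j) e (<⇒≢ i<j ∘ inj)) (lookup-replicate (l (m i)) false))

  cluster-∪ : ∀ {A B} → Across false A B → Cluster A → Cluster B → Cluster (A +ˢ B)
  cluster-∪ {A} {B} ac c d = cluster r r∈ r-≡ r-Adj
    where
    r : ∀ {v} → (A +ˢ B) v → Fin N
    r (inj₁ p) = rep c p
    r (inj₂ q) = rep d q

    r∈ : ∀ {v} (p : (A +ˢ B) v) → (A +ˢ B) (r p)
    r∈ (inj₁ p) = inj₁ (rep∈ c p)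
    r∈ (inj₂ q) = inj₂ (rep∈ d q)

    r-≡ : ∀ {u v} (p : (A +ˢ B) u) (q : (A +ˢ B) v) → Adj G u v → r p ≡ r q
    r-≡ (inj₁ p) (inj₁ q) a = rep-≡ c p q a
    r-≡ (inj₁ p) (inj₂ q) a = ⊥-elim (true≢false a (proj₂ (ac p q)))
    r-≡ (inj₂ p) (inj₁ q) a = ⊥-elim (true≢false a (proj₂ (Across-sym ac p q)))
    r-≡ (inj₂ p) (inj₂ q) a = rep-≡ d p q a

    r-Adj : ∀ {u v} (p : (A +ˢ B) u) (q : (A +ˢ B) v) → r p ≡ r q → u ≢ v → Adj G u v
    r-Adj (inj₁ p) (inj₁ q) e = rep-Adj c p q e
    r-Adj (inj₁ p) (inj₂ q) e = ⊥-elim (proj₁ (ac (rep∈ c p) (rep∈ d q)) e)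
    r-Adj (inj₂ p) (inj₁ q) e = ⊥-elim (proj₁ (ac (rep∈ c q) (rep∈ d p)) (sym e))
    r-Adj (inj₂ p) (inj₂ q) e = rep-Adj d p q e

  Part-emptyˡ : ∀ {k} {κ : Vec Bool k} {A B} → Empty A → Part κ B → Part κ (A +ˢ B)
  Part-emptyˡ e = Part-mono [ (λ p → ⊥-elim (¬Fin0 (lab e p))) , id ]

  Part-emptyʳ : ∀ {k} {κ : Vec Bool k} {A B} → Empty B → Part κ A → Part κ (A +ˢ B)
  Part-emptyʳ e = Part-mono [ id , (λ p → ⊥-elim (¬Fin0 (lab e p))) ]

  Cluster-emptyˡ : ∀ {A B} → Empty A → Cluster B → Cluster (A +ˢ B)
  Cluster-emptyˡ e = Cluster-resp [ (λ p → ⊥-elim (¬Fin0 (lab e p))) , id ] inj₂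

  Cluster-emptyʳ : ∀ {A B} → Empty B → Cluster A → Cluster (A +ˢ B)
  Cluster-emptyʳ e = Cluster-resp [ id , (λ p → ⊥-elim (¬Fin0 (lab e p))) ] inj₁

  -- Cotrees

  data Cotree : Set
  ⟦_⟧ : Cotree → VSet

  data Cotree where
    ∅    : Cotree
    leaf : Fin N → Cotree
    node : ∀ b l r → Across b ⟦ l ⟧ ⟦ r ⟧ → Cotree

  ⟦ ∅ ⟧ _ = Fin 0
  ⟦ leaf u ⟧ v = v ≡ u
  ⟦ node b l r _ ⟧ = ⟦ l ⟧ +ˢ ⟦ r ⟧

  part-∅ : ∀ {k} {κ : Vec Bool k} → Part κ ⟦ ∅ ⟧
  part-∅ = part (λ ()) (λ ())

  part-leaf : ∀ {k} {κ : Vec Bool (ℕ.suc k)} v → Part κ ⟦ leaf v ⟧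
  part-leaf v = part (λ _ → zero) λ { refl refl _ ne → ⊥-elim (ne refl) }

  vertex : ∀ {S} v → S v → K 1 ⊑ S
  vertex v p = emb ((λ _ → v) , (λ _ → label-unique _ _) , λ { 0F 0F → sym (adj-irrefl G v) }) (λ _ → p)

  cluster-leaf : ∀ v → Cluster ⟦ leaf v ⟧
  cluster-leaf v = clique⇒cluster (vertex v refl) (part-leaf v)

  -- Dichotomies on cotrees: a partition or a small induced subgraph

  inhabited? : ∀ t → Empty ⟦ t ⟧ ⊎ K 1 ⊑ ⟦ t ⟧
  inhabited? ∅ = inj₁ part-∅
  inhabited? (leaf v) = inj₂ (vertex v refl)
  inhabited? (node b l r ac) with inhabited? l | inhabited? r
  ... | inj₂ x  | _       = inj₂ (⊑-mono inj₁ x)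
  ... | inj₁ _  | inj₂ y  = inj₂ (⊑-mono inj₂ y)
  inhabited? (node true  l r ac) | inj₁ el | inj₁ er = inj₁ (merge [] [] ac el er)
  inhabited? (node false l r ac) | inj₁ el | inj₁ er = inj₁ (merge [] [] ac el er)

  clique? : ∀ t → Clique ⟦ t ⟧ ⊎ 2× K 1 ⊑ ⟦ t ⟧
  clique? ∅ = inj₁ part-∅
  clique? (leaf v) = inj₁ (part-leaf v)
  clique? (node b l r ac) with clique? l | clique? r
  ... | inj₂ x | _      = inj₂ (⊑-mono inj₁ x)
  ... | inj₁ _ | inj₂ y = inj₂ (⊑-mono inj₂ y)
  clique? (node true l r ac) | inj₁ cl | inj₁ cr = inj₁ (merge (0F ∷ []) (0F ∷ []) ac cl cr)
  clique? (node false l r ac) | inj₁ cl | inj₁ cr with inhabited? l | inhabited? r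
  ... | inj₁ el | _       = inj₁ (merge [] (0F ∷ []) ac el cr)
  ... | inj₂ _  | inj₁ er = inj₁ (merge (0F ∷ []) [] ac cl er)
  ... | inj₂ x  | inj₂ y  = inj₂ (⊑-glue ac x y)

  indep? : ∀ t → Indep ⟦ t ⟧ ⊎ K 2 ⊑ ⟦ t ⟧
  indep? ∅ = inj₁ part-∅
  indep? (leaf v) = inj₁ (part-leaf v)
  indep? (node b l r ac) with indep? l | indep? r
  ... | inj₂ x | _      = inj₂ (⊑-mono inj₁ x)
  ... | inj₁ _ | inj₂ y = inj₂ (⊑-mono inj₂ y)
  indep? (node false l r ac) | inj₁ il | inj₁ ir = inj₁ (merge (0F ∷ []) (0F ∷ []) ac il ir)
  indep? (node true l r ac) | inj₁ il | inj₁ ir with inhabited? l | inhabited? r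
  ... | inj₁ el | _       = inj₁ (merge [] (0F ∷ []) ac el ir)
  ... | inj₂ _  | inj₁ er = inj₁ (merge (0F ∷ []) [] ac il er)
  -- `⊑-glue` gives `K 1 ⊕ K 1`, whose adjacency is defined differently from that of `K 2`; the
  -- identity list converts one into the other.
  ... | inj₂ x  | inj₂ y  = inj₂ (⊑-induced (0F ∷ 1F ∷ []) (⊑-glue ac x y))

  -- In a join of inhabited sides, an edge on one side and a vertex on the other form a triangle;
  -- without such an edge the two sides are themselves the colour classes.
  bipartite? : ∀ t → Bipartite ⟦ t ⟧ ⊎ K 3 ⊑ ⟦ t ⟧
  bipartite? ∅ = inj₁ part-∅
  bipartite? (leaf v) = inj₁ (part-leaf v)
  bipartite? (node b l r ac) with bipartite? l | bipartite? r
  ... | inj₂ x | _      = inj₂ (⊑-mono inj₁ x)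
  ... | inj₁ _ | inj₂ y = inj₂ (⊑-mono inj₂ y)
  bipartite? (node false l r ac) | inj₁ bl | inj₁ br =
    inj₁ (merge (0F ∷ 1F ∷ []) (0F ∷ 1F ∷ []) ac bl br)
  bipartite? (node true l r ac) | inj₁ bl | inj₁ br with inhabited? l | inhabited? r
  ... | inj₁ el | _       = inj₁ (merge [] (0F ∷ 1F ∷ []) ac el br)
  ... | inj₂ _  | inj₁ er = inj₁ (merge (0F ∷ 1F ∷ []) [] ac bl er)
  ... | inj₂ x  | inj₂ y  with indep? l | indep? r
  ...   | inj₂ e  | _       = inj₂ (⊑-induced (0F ∷ 1F ∷ 2F ∷ []) (⊑-glue ac e y))
  ...   | inj₁ _  | inj₂ e  = inj₂ (⊑-induced (0F ∷ 1F ∷ 2F ∷ []) (⊑-glue ac x e))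
  ...   | inj₁ il | inj₁ ir = inj₁ (merge (0F ∷ []) (1F ∷ []) ac il ir)

  cluster? : ∀ t → Cluster ⟦ t ⟧ ⊎ P 3 ⊑ ⟦ t ⟧
  cluster? ∅ = inj₁ (empty⇒cluster part-∅)
  cluster? (leaf v) = inj₁ (cluster-leaf v)
  cluster? (node b l r ac) with cluster? l | cluster? r
  ... | inj₂ x | _      = inj₂ (⊑-mono inj₁ x)
  ... | inj₁ _ | inj₂ y = inj₂ (⊑-mono inj₂ y)
  cluster? (node false l r ac) | inj₁ cl | inj₁ cr = inj₁ (cluster-∪ ac cl cr)
  cluster? (node true l r ac) | inj₁ cl | inj₁ cr with inhabited? l | inhabited? r
  ... | inj₁ el | _       = inj₁ (Cluster-emptyˡ el cr)
  ... | inj₂ _  | inj₁ er = inj₁ (Cluster-emptyʳ er cl)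
  ... | inj₂ x  | inj₂ y  with clique? l | clique? r
  -- The vertex from the other side is the middle of the path.
  ...   | inj₂ e  | _       = inj₂ (⊑-induced (0F ∷ 2F ∷ 1F ∷ []) (⊑-glue ac e y))
  ...   | inj₁ _  | inj₂ e  = inj₂ (⊑-induced (1F ∷ 0F ∷ 2F ∷ []) (⊑-glue ac x e))
  ...   | inj₁ kl | inj₁ kr =
    inj₁ (clique⇒cluster (⊑-mono inj₁ x) (merge (0F ∷ []) (0F ∷ []) ac kl kr))

  -- In a union, two sides with edges give 2K₂, so otherwise one side is independent and joins the
  -- independent part. Dually, in a join `C₄`-freeness makes one side a clique, which joins the
  -- clique part.
  split? : ∀ t → Free C₄ ⟦ t ⟧ → Split ⟦ t ⟧ ⊎ 2× K 2 ⊑ ⟦ t ⟧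
  split? ∅ _ = inj₁ part-∅
  split? (leaf v) _ = inj₁ (part-leaf v)
  split? (node b l r ac) ¬C₄ with split? l (¬C₄ ∘ ⊑-mono inj₁) | split? r (¬C₄ ∘ ⊑-mono inj₂)
  ... | inj₂ x | _      = inj₂ (⊑-mono inj₁ x)
  ... | inj₁ _ | inj₂ y = inj₂ (⊑-mono inj₂ y)
  split? (node false l r ac) ¬C₄ | inj₁ sl | inj₁ sr with indep? l | indep? r
  ... | inj₁ il | _       = inj₁ (merge (1F ∷ []) (0F ∷ 1F ∷ []) ac il sr)
  ... | inj₂ _  | inj₁ ir = inj₁ (merge (0F ∷ 1F ∷ []) (1F ∷ []) ac sl ir)
  ... | inj₂ x  | inj₂ y  = inj₂ (⊑-glue ac x y)
  split? (node true l r ac) ¬C₄ | inj₁ sl | inj₁ sr with clique? l | clique? r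
  ... | inj₁ kl | _       = inj₁ (merge (0F ∷ []) (0F ∷ 1F ∷ []) ac kl sr)
  ... | inj₂ _  | inj₁ kr = inj₁ (merge (0F ∷ 1F ∷ []) (0F ∷ []) ac sl kr)
  ... | inj₂ x  | inj₂ y  = ⊥-elim (¬C₄ (⊑-glue ac x y))

  -- The excluded graphs are P₃ and its complement. In a join of inhabited sides a non-edge extends
  -- to P₃, and in a union an edge extends to `K 1 ∪ K 2`.
  clique-or-indep : ∀ t → Free (P 3) ⟦ t ⟧ → Free (K 1 ∪ K 2) ⟦ t ⟧ → Clique ⟦ t ⟧ ⊎ Indep ⟦ t ⟧
  clique-or-indep ∅ _ _ = inj₁ part-∅
  clique-or-indep (leaf v) _ _ = inj₁ (part-leaf v)
  clique-or-indep (node b l r ac) ¬P ¬E with inhabited? l | inhabited? r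
  ... | inj₁ el | _ = Sum.map (Part-emptyˡ el) (Part-emptyˡ el)
    (clique-or-indep r (¬P ∘ ⊑-mono inj₂) (¬E ∘ ⊑-mono inj₂))
  ... | inj₂ _ | inj₁ er = Sum.map (Part-emptyʳ er) (Part-emptyʳ er)
    (clique-or-indep l (¬P ∘ ⊑-mono inj₁) (¬E ∘ ⊑-mono inj₁))
  clique-or-indep (node true  l r ac) ¬P ¬E | inj₂ x | inj₂ y with clique? l | clique? r
  ... | inj₁ kl | inj₁ kr = inj₁ (merge (0F ∷ []) (0F ∷ []) ac kl kr)
  ... | inj₂ e  | _       = ⊥-elim (¬P (⊑-induced (0F ∷ 2F ∷ 1F ∷ []) (⊑-glue ac e y)))
  ... | inj₁ _  | inj₂ e  = ⊥-elim (¬P (⊑-induced (1F ∷ 0F ∷ 2F ∷ []) (⊑-glue ac x e)))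
  clique-or-indep (node false l r ac) ¬P ¬E | inj₂ x | inj₂ y with indep? l | indep? r
  ... | inj₁ il | inj₁ ir = inj₂ (merge (0F ∷ []) (0F ∷ []) ac il ir)
  ... | inj₂ e  | _       = ⊥-elim (¬E (⊑-induced (2F ∷ 0F ∷ 1F ∷ []) (⊑-glue ac e y)))
  ... | inj₁ _  | inj₂ e  = ⊥-elim (¬E (⊑-glue ac x e))

  -- In a join, a vertex of the opposite side extends P₃ to `diamond` and `K 1 ∪ K 2` to `paw`, so
  -- each inhabited side is a clique or independent. In a union, a side that is not bipartite has a
  -- triangle, which forbids P₃ on the other side.
  bipartite-or-cluster : ∀ t → Free diamond ⟦ t ⟧ → Free paw ⟦ t ⟧ → Free (P 3 ∪ K 3) ⟦ t ⟧ →
    Bipartite ⟦ t ⟧ ⊎ Cluster ⟦ t ⟧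
  bipartite-or-cluster ∅ _ _ _ = inj₁ part-∅
  bipartite-or-cluster (leaf v) _ _ _ = inj₁ (part-leaf v)
  bipartite-or-cluster (node false l r ac) ¬D ¬W ¬PK
    with bipartite-or-cluster l (¬D ∘ ⊑-mono inj₁) (¬W ∘ ⊑-mono inj₁) (¬PK ∘ ⊑-mono inj₁)
       | bipartite-or-cluster r (¬D ∘ ⊑-mono inj₂) (¬W ∘ ⊑-mono inj₂) (¬PK ∘ ⊑-mono inj₂)
  ... | inj₁ bl | inj₁ br = inj₁ (merge (0F ∷ 1F ∷ []) (0F ∷ 1F ∷ []) ac bl br)
  ... | inj₂ cl | inj₂ cr = inj₂ (cluster-∪ ac cl cr)
  ... | inj₁ bl | inj₂ cr with bipartite? r | cluster? l
  ...   | inj₁ br | _       = inj₁ (merge (0F ∷ 1F ∷ []) (0F ∷ 1F ∷ []) ac bl br)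
  ...   | inj₂ _  | inj₁ cl = inj₂ (cluster-∪ ac cl cr)
  ...   | inj₂ k  | inj₂ p  = ⊥-elim (¬PK (⊑-glue ac p k))
  bipartite-or-cluster (node false l r ac) ¬D ¬W ¬PK
      | inj₂ cl | inj₁ br with bipartite? l | cluster? r
  ...   | inj₁ bl | _       = inj₁ (merge (0F ∷ 1F ∷ []) (0F ∷ 1F ∷ []) ac bl br)
  ...   | inj₂ _  | inj₁ cr = inj₂ (cluster-∪ ac cl cr)
  ...   | inj₂ k  | inj₂ p  = ⊥-elim (¬PK (⊑-induced (3F ∷ 4F ∷ 5F ∷ 0F ∷ 1F ∷ 2F ∷ []) (⊑-glue ac k p)))
  bipartite-or-cluster (node true l r ac) ¬D ¬W ¬PK with inhabited? l | inhabited? r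
  ... | inj₁ el | _ = Sum.map (Part-emptyˡ el) (Cluster-emptyˡ el)
    (bipartite-or-cluster r (¬D ∘ ⊑-mono inj₂) (¬W ∘ ⊑-mono inj₂) (¬PK ∘ ⊑-mono inj₂))
  ... | inj₂ _ | inj₁ er = Sum.map (Part-emptyʳ er) (Cluster-emptyʳ er)
    (bipartite-or-cluster l (¬D ∘ ⊑-mono inj₁) (¬W ∘ ⊑-mono inj₁) (¬PK ∘ ⊑-mono inj₁))
  ... | inj₂ x | inj₂ y
    with clique-or-indep l (λ p → ¬D (⊑-glue ac p y))
           (λ e → ¬W (⊑-induced (3F ∷ 0F ∷ 1F ∷ 2F ∷ []) (⊑-glue ac e y)))
       | clique-or-indep r (λ p → ¬D (⊑-induced (1F ∷ 2F ∷ 3F ∷ 0F ∷ []) (⊑-glue ac x p)))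
           (λ e → ¬W (⊑-glue ac x e))
  ...   | inj₁ kl | inj₁ kr =
    inj₂ (clique⇒cluster (⊑-mono inj₁ x) (merge (0F ∷ []) (0F ∷ []) ac kl kr))
  ...   | inj₂ il | inj₂ ir = inj₁ (merge (0F ∷ []) (1F ∷ []) ac il ir)
  ...   | inj₁ kl | inj₂ ir with clique? r | indep? l
  ...     | inj₁ kr | _ = inj₂ (clique⇒cluster (⊑-mono inj₁ x) (merge (0F ∷ []) (0F ∷ []) ac kl kr))
  ...     | inj₂ _ | inj₁ il = inj₁ (merge (0F ∷ []) (1F ∷ []) ac il ir)
  -- `diamond` is also an edge joined to a non-edge.
  ...     | inj₂ n | inj₂ e = ⊥-elim (¬D (⊑-induced (2F ∷ 0F ∷ 3F ∷ 1F ∷ []) (⊑-glue ac e n)))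
  bipartite-or-cluster (node true l r ac) ¬D ¬W ¬PK | inj₂ x | inj₂ y
        | inj₂ il | inj₁ kr with clique? l | indep? r
  ...     | inj₁ kl | _ = inj₂ (clique⇒cluster (⊑-mono inj₁ x) (merge (0F ∷ []) (0F ∷ []) ac kl kr))
  ...     | inj₂ _ | inj₁ ir = inj₁ (merge (0F ∷ []) (1F ∷ []) ac il ir)
  ...     | inj₂ n | inj₂ e = ⊥-elim (¬D (⊑-induced (0F ∷ 2F ∷ 1F ∷ 3F ∷ []) (⊑-glue ac n e)))

  -- In a union, an independent side is absorbed into either outcome; if both sides have edges, a P₃
  -- in one would give `P 3 ∪ K 2`. In a join, a vertex of the other side forbids 2K₂, so both sides
  -- are split and `C₄`-freeness makes one a clique.
  split-or-cluster : ∀ t → Free C₄ ⟦ t ⟧ → Free (P 3 ∪ K 2) ⟦ t ⟧ → Free (K 1 ⊕ 2× K 2) ⟦ t ⟧ →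
    Split ⟦ t ⟧ ⊎ Cluster ⟦ t ⟧
  split-or-cluster ∅ _ _ _ = inj₁ part-∅
  split-or-cluster (leaf v) _ _ _ = inj₁ (part-leaf v)
  split-or-cluster (node false l r ac) ¬C₄ ¬PK ¬B with indep? l | indep? r
  ... | inj₁ il | _ = Sum.map (merge (1F ∷ []) (0F ∷ 1F ∷ []) ac il) (cluster-∪ ac (indep⇒cluster il))
    (split-or-cluster r (¬C₄ ∘ ⊑-mono inj₂) (¬PK ∘ ⊑-mono inj₂) (¬B ∘ ⊑-mono inj₂))
  ... | inj₂ _ | inj₁ ir =
    Sum.map (λ sl → merge (0F ∷ 1F ∷ []) (1F ∷ []) ac sl ir) (λ cl → cluster-∪ ac cl (indep⇒cluster ir))
    (split-or-cluster l (¬C₄ ∘ ⊑-mono inj₁) (¬PK ∘ ⊑-mono inj₁) (¬B ∘ ⊑-mono inj₁))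
  ... | inj₂ x | inj₂ y with cluster? l | cluster? r
  ...   | inj₁ cl | inj₁ cr = inj₂ (cluster-∪ ac cl cr)
  ...   | inj₂ p  | _       = ⊥-elim (¬PK (⊑-glue ac p y))
  ...   | inj₁ _  | inj₂ p  = ⊥-elim (¬PK (⊑-induced (2F ∷ 3F ∷ 4F ∷ 0F ∷ 1F ∷ []) (⊑-glue ac x p)))
  split-or-cluster (node true l r ac) ¬C₄ ¬PK ¬B with inhabited? l | inhabited? r
  ... | inj₁ el | _ = Sum.map (Part-emptyˡ el) (Cluster-emptyˡ el)
    (split-or-cluster r (¬C₄ ∘ ⊑-mono inj₂) (¬PK ∘ ⊑-mono inj₂) (¬B ∘ ⊑-mono inj₂))
  ... | inj₂ _ | inj₁ er = Sum.map (Part-emptyʳ er) (Cluster-emptyʳ er)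
    (split-or-cluster l (¬C₄ ∘ ⊑-mono inj₁) (¬PK ∘ ⊑-mono inj₁) (¬B ∘ ⊑-mono inj₁))
  ... | inj₂ x | inj₂ y with split? l (¬C₄ ∘ ⊑-mono inj₁) | split? r (¬C₄ ∘ ⊑-mono inj₂)
  ...   | inj₂ e  | _      = ⊥-elim (¬B (⊑-induced (4F ∷ 0F ∷ 1F ∷ 2F ∷ 3F ∷ []) (⊑-glue ac e y)))
  ...   | inj₁ _  | inj₂ e = ⊥-elim (¬B (⊑-glue ac x e))
  ...   | inj₁ sl | inj₁ sr with clique? l | clique? r
  ...     | inj₁ kl | _       = inj₁ (merge (0F ∷ []) (0F ∷ 1F ∷ []) ac kl sr)
  ...     | inj₂ _  | inj₁ kr = inj₁ (merge (0F ∷ 1F ∷ []) (0F ∷ []) ac sl kr)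
  ...     | inj₂ m  | inj₂ n  = ⊥-elim (¬C₄ (⊑-glue ac m n))

  -- Every cograph has a cotree

  uniform? : ∀ v b t → (∀ {x} → ⟦ t ⟧ x → adj G v x ≡ b) ⊎ (∃ λ x → ⟦ t ⟧ x × adj G v x ≡ not b)
  uniform? v b ∅ = inj₁ λ ()
  uniform? v b (leaf u) with adj G v u Bool.≟ b
  ... | yes e = inj₁ λ { refl → e }
  ... | no ne = inj₂ (u , refl , Bool.¬-not ne)
  uniform? v b (node _ l r _) with uniform? v b l | uniform? v b r
  ... | inj₁ f           | inj₁ g           = inj₁ [ f , g ]
  ... | inj₂ (x , p , e) | _                = inj₂ (x , inj₁ p , e)
  ... | inj₁ _           | inj₂ (x , p , e) = inj₂ (x , inj₂ p , e)

  restrict : ∀ v c t → Σ Cotree λ t′ →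
    (∀ {x} → ⟦ t′ ⟧ x → ⟦ t ⟧ x × adj G v x ≡ c) × (∀ {x} → ⟦ t ⟧ x → adj G v x ≡ c → ⟦ t′ ⟧ x)
  restrict v c ∅ = ∅ , (λ ()) , (λ ())
  restrict v c (leaf u) with adj G v u Bool.≟ c
  ... | yes e = leaf u , (λ { refl → refl , e }) , (λ p _ → p)
  ... | no ne = ∅ , (λ ()) , (λ { refl e → ⊥-elim (ne e) })
  restrict v c (node b l r ac) with restrict v c l | restrict v c r
  ... | l′ , l-sound , l-complete | r′ , r-sound , r-complete =
    node b l′ r′ (λ p q → ac (proj₁ (l-sound p)) (proj₁ (r-sound q))) ,
    (λ { (inj₁ p) → inj₁ (proj₁ (l-sound p)) , proj₂ (l-sound p)
       ; (inj₂ q) → inj₂ (proj₁ (r-sound q)) , proj₂ (r-sound q) }) ,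
    (λ { (inj₁ p) e → inj₁ (l-complete p e) ; (inj₂ q) e → inj₂ (r-complete q e) })

  -- P₄ is self-complementary, so a path in either colour class gives an induced P₄.
  path₄ : ∀ c {x y z w} → x ≢ y → x ≢ z → x ≢ w → y ≢ z → y ≢ w → z ≢ w →
    adj G x y ≡ c → adj G y z ≡ c → adj G z w ≡ c →
    adj G x z ≡ not c → adj G x w ≡ not c → adj G y w ≡ not c → InducedSub (P 4) G
  path₄ true {x} {y} {z} {w} xy xz xw yz yw zw Exy Eyz Ezw Exz Exw Eyw =
    f , f-inj _ _ , f-adj
    where
    f : Fin 4 → Fin N
    f = lookup (x ∷ y ∷ z ∷ w ∷ [])

    f-inj : ∀ i j → f i ≡ f j → i ≡ j
    f-inj 0F 0F e = refl
    f-inj 0F 1F e = ⊥-elim (xy e)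
    f-inj 0F 2F e = ⊥-elim (xz e)
    f-inj 0F 3F e = ⊥-elim (xw e)
    f-inj 1F 0F e = ⊥-elim (xy (sym e))
    f-inj 1F 1F e = refl
    f-inj 1F 2F e = ⊥-elim (yz e)
    f-inj 1F 3F e = ⊥-elim (yw e)
    f-inj 2F 0F e = ⊥-elim (xz (sym e))
    f-inj 2F 1F e = ⊥-elim (yz (sym e))
    f-inj 2F 2F e = refl
    f-inj 2F 3F e = ⊥-elim (zw e)
    f-inj 3F 0F e = ⊥-elim (xw (sym e))
    f-inj 3F 1F e = ⊥-elim (yw (sym e))
    f-inj 3F 2F e = ⊥-elim (zw (sym e))
    f-inj 3F 3F e = refl

    f-adj : ∀ i j → adj (P 4) i j ≡ adj G (f i) (f j)
    f-adj 0F 0F = sym (adj-irrefl G x)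
    f-adj 0F 1F = sym Exy
    f-adj 0F 2F = sym Exz
    f-adj 0F 3F = sym Exw
    f-adj 1F 0F = sym (trans (adj-sym G y x) Exy)
    f-adj 1F 1F = sym (adj-irrefl G y)
    f-adj 1F 2F = sym Eyz
    f-adj 1F 3F = sym Eyw
    f-adj 2F 0F = sym (trans (adj-sym G z x) Exz)
    f-adj 2F 1F = sym (trans (adj-sym G z y) Eyz)
    f-adj 2F 2F = sym (adj-irrefl G z)
    f-adj 2F 3F = sym Ezw
    f-adj 3F 0F = sym (trans (adj-sym G w x) Exw)
    f-adj 3F 1F = sym (trans (adj-sym G w y) Eyw)
    f-adj 3F 2F = sym (trans (adj-sym G w z) Ezw)
    f-adj 3F 3F = sym (adj-irrefl G w)
  -- The complement of the path x, y, z, w is the path y, w, x, z.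
  path₄ false {x} {y} {z} {w} xy xz xw yz yw zw Exy Eyz Ezw Exz Exw Eyw =
    path₄ true (yw) (xy ∘ sym) yz (xw ∘ sym) (zw ∘ sym) xz
      Eyw (trans (adj-sym G w x) Exw) Exz (trans (adj-sym G y x) Exy) Eyz (trans (adj-sym G w z) Ezw)

  module _ (cograph : Cograph G) where

    -- Otherwise x, v, u, w would be a P₄ in colour not b.
    no-crossing : ∀ {A B b v x u w} → Across b A B → (∀ {z} → (A +ˢ B) z → v ≢ z) →
      B x → adj G v x ≡ not b → A u → A w → u ≢ w → adj G v u ≡ not b → adj G v w ≡ b → adj G u w ≡ b
    no-crossing {b = b} {v} {x} {u} {w} ac fresh q vx p p′ u≢w vu vw with adj G u w Bool.≟ b
    ... | yes e = e
    ... | no ne = ⊥-elim (cograph (path₄ (not b)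
      (fresh (inj₂ q) ∘ sym) (proj₁ (Across-sym ac q p)) (proj₁ (Across-sym ac q p′))
      (fresh (inj₁ p)) (fresh (inj₁ p′)) u≢w
      (trans (adj-sym G x v) vx) vu (Bool.¬-not ne)
      (trans (proj₂ (Across-sym ac q p)) b≡) (trans (proj₂ (Across-sym ac q p′)) b≡) (trans vw b≡)))
      where
      b≡ : b ≡ not (not b)
      b≡ = sym (Bool.not-involutive b)

    -- If `v` has colour `b` to all of one side, it is inserted recursively into the other.
    -- Otherwise each side has a vertex of colour `not b` to `v`, and P₄-freeness determines a new
    -- tree.
    insert : ∀ v t → (∀ {x} → ⟦ t ⟧ x → v ≢ x) → Σ Cotree λ t′ →
      (∀ {x} → ⟦ t′ ⟧ x → x ≡ v ⊎ ⟦ t ⟧ x) × (∀ {x} → x ≡ v ⊎ ⟦ t ⟧ x → ⟦ t′ ⟧ x)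
    insert v ∅ fresh = leaf v , inj₁ , λ { (inj₁ e) → e }
    insert v (leaf u) fresh =
      node (adj G v u) (leaf v) (leaf u) (λ { refl refl → fresh refl , refl }) , id , id
    insert v (node b l r ac) fresh with uniform? v b l | uniform? v b r
    ... | inj₁ vl | _ with insert v r (fresh ∘ inj₂)
    ...   | r′ , sound , complete = node b l r′ across ,
      [ inj₂ ∘ inj₁ , Sum.map₂ inj₂ ∘ sound ] ,
      [ inj₂ ∘ complete ∘ inj₁ , Sum.map₂ (complete ∘ inj₂) ]
      where
      across : Across b ⟦ l ⟧ ⟦ r′ ⟧
      across {u} p q with sound q
      ... | inj₁ refl = fresh (inj₁ p) ∘ sym , trans (adj-sym G u v) (vl p)
      ... | inj₂ q′   = ac p q′
    insert v (node b l r ac) fresh | inj₂ _ | inj₁ vr with insert v l (fresh ∘ inj₁)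
    ...   | l′ , sound , complete = node b l′ r across ,
      [ Sum.map₂ inj₁ ∘ sound , inj₂ ∘ inj₂ ] ,
      [ inj₁ ∘ complete ∘ inj₁ , Sum.map₁ (complete ∘ inj₂) ]
      where
      across : Across b ⟦ l′ ⟧ ⟦ r ⟧
      across p q with sound p
      ... | inj₁ refl = fresh (inj₂ q) , vr q
      ... | inj₂ p′   = ac p′ q
    insert v t@(node b l r ac) fresh | inj₂ (x , p , vx) | inj₂ (y , q , vy)
      with restrict v (not b) t | restrict v b t
    ... | t₁ , sound₁ , complete₁ | t₂ , sound₂ , complete₂ =
      -- `t₁` and `t₂` collect the vertices of colour `not b` and `b` to `v`. Pairs between them
      -- have colour `b`: by `ac` if they lie on different sides, and by `no-crossing` with the
      -- witness `x` or `y` of the opposite side otherwise.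
      node b (node (not b) (leaf v) t₁ across₁) t₂ across₂ ,
      [ Sum.map₂ (proj₁ ∘ sound₁) , inj₂ ∘ proj₁ ∘ sound₂ ] ,
      [ inj₁ ∘ inj₁ , place ]
      where
      across₁ : Across (not b) ⟦ leaf v ⟧ ⟦ t₁ ⟧
      across₁ refl m = fresh (proj₁ (sound₁ m)) , proj₂ (sound₁ m)

      cross : ∀ {u w} → ⟦ t ⟧ u → ⟦ t ⟧ w → u ≢ w → adj G v u ≡ not b → adj G v w ≡ b → adj G u w ≡ b
      cross (inj₁ m) (inj₂ n) _ _ _ = proj₂ (ac m n)
      cross (inj₂ m) (inj₁ n) _ _ _ = proj₂ (Across-sym ac m n)
      cross (inj₁ m) (inj₁ n) = no-crossing ac fresh q vy m n
      cross (inj₂ m) (inj₂ n) = no-crossing (Across-sym ac) (fresh ∘ swap) p vx m n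

      across₂ : Across b (⟦ leaf v ⟧ +ˢ ⟦ t₁ ⟧) ⟦ t₂ ⟧
      across₂ (inj₁ refl) n = fresh (proj₁ (sound₂ n)) , proj₂ (sound₂ n)
      across₂ {u} {w} (inj₂ m) n with sound₁ m | sound₂ n
      ... | m′ , vu | n′ , vw = u≢w , cross m′ n′ u≢w vu vw
        where
        u≢w : u ≢ w
        u≢w refl = Bool.not-¬ vw vu

      place : ∀ {x} → ⟦ t ⟧ x → (⟦ leaf v ⟧ +ˢ ⟦ t₁ ⟧ +ˢ ⟦ t₂ ⟧) x
      place {x} m with adj G v x Bool.≟ b
      ... | yes e = inj₂ (complete₂ m e)
      ... | no ne = inj₁ (inj₂ (complete₁ m (Bool.¬-not ne)))

    cotree : ∀ xs → Unique xs → Σ Cotree λ t →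
      (∀ {x} → ⟦ t ⟧ x → x ∈ xs) × (∀ {x} → x ∈ xs → ⟦ t ⟧ x)
    cotree [] _ = ∅ , (λ ()) , (λ ())
    cotree (v ∷ xs) (v∉ ∷ unique) with cotree xs unique
    ... | t , sound , complete with insert v t (All.lookup v∉ ∘ sound)
    ...   | t′ , sound′ , complete′ = t′ ,
      (λ p → [ here , there ∘ sound ] (sound′ p)) ,
      (λ { (here e) → complete′ (inj₁ e) ; (there m) → complete′ (inj₂ (complete m)) })

    spanning-cotree : Σ Cotree λ t → ∀ v → ⟦ t ⟧ v
    spanning-cotree with cotree (allFin N) (allFin⁺ N)
    ... | t , _ , complete = t , λ v → complete (∈-allFin v)

  -- Partitions from the eight excluded subgraphs

  module Structure (connected : Connected G)
    (¬R₁ : ¬ InducedSub R1 G) (¬R₂ : ¬ InducedSub R2 G) (¬R₃ : ¬ InducedSub R3 G) (¬R₄ : ¬ InducedSub R4 G)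
    (¬R₅ : ¬ InducedSub R5 G) (¬R₆ : ¬ InducedSub R6 G) (¬R₇ : ¬ InducedSub R7 G) (¬R₈ : ¬ InducedSub R8 G)
    where

    free : ∀ {m} {H : Graph m} {S} → ¬ InducedSub H G → Free H S
    free ¬H (emb f _) = ¬H f

    -- `C₄` on one side and a non-edge on the other form `R1`, so both sides are split; their
    -- cliques unite across the join and their independent sets stay apart.
    oneTwo-⊕ : ∀ l r (ac : Across true ⟦ l ⟧ ⟦ r ⟧) → Free (2× K 1 ⊕ 2× K 2) ⟦ node true l r ac ⟧ →
      2× K 1 ⊑ ⟦ l ⟧ → 2× K 1 ⊑ ⟦ r ⟧ → OneTwo ⟦ node true l r ac ⟧
    oneTwo-⊕ l r ac ¬D x y
      with split? l (λ c → free {H = R1} ¬R₁ (⊑-glue ac c y))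
         | split? r (λ c → free {H = R1} ¬R₁ (⊑-induced (0F ∷ 1F ∷ 2F ∷ 3F ∷ 4F ∷ 5F ∷ []) (⊑-glue ac x c)))
    ... | inj₁ sl | inj₁ sr = merge (0F ∷ 1F ∷ []) (0F ∷ 2F ∷ []) ac sl sr
    ... | inj₂ e  | _       = ⊥-elim (¬D (⊑-induced (4F ∷ 5F ∷ 0F ∷ 1F ∷ 2F ∷ 3F ∷ []) (⊑-glue ac e y)))
    ... | inj₁ _  | inj₂ e  = ⊥-elim (¬D (⊑-glue ac x e))

    -- In a union, two sides with triangles give 2K₃; otherwise a bipartite side fits into the two
    -- independent sets of the other. In a join, a clique side enlarges the clique, and `oneTwo-⊕`
    -- settles the rest.
    oneTwo? : ∀ t → Free (2× K 1 ⊕ 2× K 2) ⟦ t ⟧ → OneTwo ⟦ t ⟧ ⊎ 2× K 3 ⊑ ⟦ t ⟧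
    oneTwo? ∅ _ = inj₁ part-∅
    oneTwo? (leaf v) _ = inj₁ (part-leaf v)
    oneTwo? (node b l r ac) ¬D with oneTwo? l (¬D ∘ ⊑-mono inj₁) | oneTwo? r (¬D ∘ ⊑-mono inj₂)
    ... | inj₂ e | _      = inj₂ (⊑-mono inj₁ e)
    ... | inj₁ _ | inj₂ e = inj₂ (⊑-mono inj₂ e)
    oneTwo? (node false l r ac) ¬D | inj₁ ol | inj₁ or with bipartite? l | bipartite? r
    ... | inj₁ bl | _       = inj₁ (merge (1F ∷ 2F ∷ []) (0F ∷ 1F ∷ 2F ∷ []) ac bl or)
    ... | inj₂ _  | inj₁ br = inj₁ (merge (0F ∷ 1F ∷ 2F ∷ []) (1F ∷ 2F ∷ []) ac ol br)
    ... | inj₂ x  | inj₂ y  = inj₂ (⊑-glue ac x y)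
    oneTwo? (node true l r ac) ¬D | inj₁ ol | inj₁ or with clique? l | clique? r
    ... | inj₁ kl | _       = inj₁ (merge (0F ∷ []) (0F ∷ 1F ∷ 2F ∷ []) ac kl or)
    ... | inj₂ _  | inj₁ kr = inj₁ (merge (0F ∷ 1F ∷ 2F ∷ []) (0F ∷ []) ac ol kr)
    ... | inj₂ x  | inj₂ y  = inj₁ (oneTwo-⊕ l r ac ¬D x y)

    -- With the triangle in `B` and a vertex of `Z`, the graphs excluded by `bipartite-or-cluster`
    -- become `R7`, `R8` and `R6`. The triangle in `t` itself rules out the bipartite outcome.
    cluster-beside-K₃ : ∀ {Z B} → K 1 ⊑ Z → ∀ t → Across true Z (B +ˢ ⟦ t ⟧) → Across false B ⟦ t ⟧ →
      K 3 ⊑ B → K 3 ⊑ ⟦ t ⟧ → Cluster ⟦ t ⟧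
    cluster-beside-K₃ z t za ac x y with bipartite-or-cluster t
      (λ d → free {H = R7} ¬R₇ (⊑-glue za z (⊑-glue ac x d)))
      (λ w → free {H = R8} ¬R₈ (⊑-glue za z (⊑-glue ac x w)))
      (λ p → free {H = R6} ¬R₆ (⊑-glue za z
        (⊑-induced (3F ∷ 4F ∷ 5F ∷ 6F ∷ 7F ∷ 8F ∷ 0F ∷ 1F ∷ 2F ∷ []) (⊑-glue ac x p))))
    ... | inj₁ bt = ⊥-elim (bipartite⇒K₃-free bt y)
    ... | inj₂ ct = ct

    -- In a join, 2K₃ in one side gives `R5` with a vertex of the other and one of `Z`. In a union,
    -- if one side is bipartite and the other contains 2K₃, then `R6` makes the bipartite side a
    -- cluster and the recursion continues in the other; if both have triangles, `cluster-beside-K₃`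
    -- applies to each.
    oneTwo-or-cluster : ∀ {Z} → K 1 ⊑ Z → ∀ t → Across true Z ⟦ t ⟧ → OneTwo ⟦ t ⟧ ⊎ Cluster ⟦ t ⟧
    oneTwo-or-cluster z ∅ _ = inj₁ part-∅
    oneTwo-or-cluster z (leaf v) _ = inj₁ (part-leaf v)
    oneTwo-or-cluster z (node true l r ac) za with inhabited? l | inhabited? r
    ... | inj₁ el | _ = Sum.map (Part-emptyˡ el) (Cluster-emptyˡ el)
      (oneTwo-or-cluster z r (λ p q → za p (inj₂ q)))
    ... | inj₂ _ | inj₁ er = Sum.map (Part-emptyʳ er) (Cluster-emptyʳ er)
      (oneTwo-or-cluster z l (λ p q → za p (inj₁ q)))
    ... | inj₂ x | inj₂ y
      with oneTwo? l (λ d → free {H = R4} ¬R₄ (⊑-glue za z (⊑-mono inj₁ d)))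
         | oneTwo? r (λ d → free {H = R4} ¬R₄ (⊑-glue za z (⊑-mono inj₂ d)))
    ...   | inj₂ e | _ = ⊥-elim (free {H = R5} ¬R₅
      (⊑-induced (0F ∷ 7F ∷ 1F ∷ 2F ∷ 3F ∷ 4F ∷ 5F ∷ 6F ∷ []) (⊑-glue za z (⊑-glue ac e y))))
    ...   | inj₁ _ | inj₂ e = ⊥-elim (free {H = R5} ¬R₅
      (⊑-induced (0F ∷ 1F ∷ 2F ∷ 3F ∷ 4F ∷ 5F ∷ 6F ∷ 7F ∷ []) (⊑-glue za z (⊑-glue ac x e))))
    ...   | inj₁ ol | inj₁ or with clique? l | clique? r
    ...     | inj₁ kl | _       = inj₁ (merge (0F ∷ []) (0F ∷ 1F ∷ 2F ∷ []) ac kl or)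
    ...     | inj₂ _  | inj₁ kr = inj₁ (merge (0F ∷ 1F ∷ 2F ∷ []) (0F ∷ []) ac ol kr)
    ...     | inj₂ m  | inj₂ n  =
      inj₁ (oneTwo-⊕ l r ac (λ d → free {H = R4} ¬R₄ (⊑-glue za z d)) m n)
    oneTwo-or-cluster z (node false l r ac) za with bipartite? l | bipartite? r
    ... | inj₁ bl | _ with oneTwo? r (λ d → free {H = R4} ¬R₄ (⊑-glue za z (⊑-mono inj₂ d)))
    ...   | inj₁ or = inj₁ (merge (1F ∷ 2F ∷ []) (0F ∷ 1F ∷ 2F ∷ []) ac bl or)
    ...   | inj₂ e with cluster? l
    ...     | inj₁ cl = Sum.map (merge (1F ∷ 2F ∷ []) (0F ∷ 1F ∷ 2F ∷ []) ac bl) (cluster-∪ ac cl)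
      (oneTwo-or-cluster z r (λ p q → za p (inj₂ q)))
    ...     | inj₂ p = ⊥-elim (free {H = R6} ¬R₆ (⊑-glue za z (⊑-glue ac p e)))
    oneTwo-or-cluster z (node false l r ac) za
        | inj₂ _ | inj₁ br with oneTwo? l (λ d → free {H = R4} ¬R₄ (⊑-glue za z (⊑-mono inj₁ d)))
    ...   | inj₁ ol = inj₁ (merge (0F ∷ 1F ∷ 2F ∷ []) (1F ∷ 2F ∷ []) ac ol br)
    ...   | inj₂ e with cluster? r
    ...     | inj₁ cr = Sum.map (λ ol → merge (0F ∷ 1F ∷ 2F ∷ []) (1F ∷ 2F ∷ []) ac ol br)
                                (λ cl → cluster-∪ ac cl cr)
      (oneTwo-or-cluster z l (λ p q → za p (inj₁ q)))
    ...     | inj₂ p = ⊥-elim (free {H = R6} ¬R₆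
      (⊑-glue za z (⊑-induced (6F ∷ 7F ∷ 8F ∷ 0F ∷ 1F ∷ 2F ∷ 3F ∷ 4F ∷ 5F ∷ []) (⊑-glue ac e p))))
    oneTwo-or-cluster z (node false l r ac) za
        | inj₂ x | inj₂ y =
      inj₂ (cluster-∪ ac (cluster-beside-K₃ z l (λ p → za p ∘ swap) (Across-sym ac) y x)
                         (cluster-beside-K₃ z r za ac x y))

    monopolar-∪ : ∀ {A B} → (∀ v → (A +ˢ B) v) → Cluster A → Indep B → Monopolar G
    monopolar-∪ {A} {B} cover c i = side ∘ cover , label ∘ cover ,
      (λ u v e f ne → clusters (cover u) (cover v) e f ne) , (λ u v e f → independent (cover u) (cover v) e f)
      where
      side : ∀ {v} → (A +ˢ B) v → Bool
      side (inj₁ _) = true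
      side (inj₂ _) = false

      label : ∀ {v} → (A +ˢ B) v → Fin N
      label (inj₁ p) = rep c p
      label {v} (inj₂ _) = v

      clusters : ∀ {u v} (p : (A +ˢ B) u) (q : (A +ˢ B) v) → side p ≡ true → side q ≡ true → u ≢ v →
        (Adj G u v → label p ≡ label q) × (label p ≡ label q → Adj G u v)
      clusters (inj₁ p) (inj₁ q) _ _ ne = rep-≡ c p q , λ e → rep-Adj c p q e ne

      independent : ∀ {u v} (p : (A +ˢ B) u) (q : (A +ˢ B) v) → side p ≡ false → side q ≡ false →
        adj G u v ≡ false
      independent (inj₂ p) (inj₂ q) _ _ = indep-¬Adj i p q

    oneTwo-cover : ∀ {S} → (∀ v → S v) → OneTwo S → OneTwoPartitionable G
    oneTwo-cover cover (part l h) = l ∘ cover ,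
      (λ u v e f ne → trans (h (cover u) (cover v) (trans e (sym f)) ne) (cong (lookup (true ∷ false ∷ false ∷ [])) e)) ,
      independent
      where
      kind : ∀ i → i ≢ 0F → lookup (true ∷ false ∷ false ∷ []) i ≡ false
      kind 0F ne = ⊥-elim (ne refl)
      kind 1F _  = refl
      kind 2F _  = refl

      independent : ∀ u v → l (cover u) ≢ 0F → l (cover u) ≡ l (cover v) → adj G u v ≡ false
      independent u v ne e with u ≟ v
      ... | yes refl = adj-irrefl G u
      ... | no u≢v   = trans (h (cover u) (cover v) e u≢v) (kind _ ne)

    -- The 2K₂ in `l` turns P₃ or `K 1 ∪ K 2` in `r` into `R4` or `R2`, so `r` is independent. The
    -- non-edge in `r` turns the graphs excluded by `split-or-cluster` into `R1`, `R3` and `R4`.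
    nearlySplit-2K₂ : ∀ l r (ac : Across true ⟦ l ⟧ ⟦ r ⟧) → (∀ v → ⟦ node true l r ac ⟧ v) →
      2× K 2 ⊑ ⟦ l ⟧ → 2× K 1 ⊑ ⟦ r ⟧ → MonopolarNearlySplit G
    nearlySplit-2K₂ l r ac cover e y
      with clique-or-indep r
             -- The middle of the path serves as the dominating vertex of `R4`, its ends as the 2K₁.
             (λ p → free {H = R4} ¬R₄ (⊑-induced (5F ∷ 4F ∷ 6F ∷ 0F ∷ 1F ∷ 2F ∷ 3F ∷ []) (⊑-glue ac e p)))
             (λ p → free {H = R2} ¬R₂ (⊑-induced (0F ∷ 1F ∷ 2F ∷ 3F ∷ 5F ∷ 6F ∷ 4F ∷ []) (⊑-glue ac e p)))
         | split-or-cluster l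
             (λ p → free {H = R1} ¬R₁ (⊑-glue ac p y))
             (λ p → free {H = R3} ¬R₃ (⊑-induced (5F ∷ 6F ∷ 0F ∷ 1F ∷ 2F ∷ 3F ∷ 4F ∷ []) (⊑-glue ac p y)))
             (λ p → free {H = R4} ¬R₄ (⊑-induced (0F ∷ 5F ∷ 6F ∷ 1F ∷ 2F ∷ 3F ∷ 4F ∷ []) (⊑-glue ac p y)))
    ... | inj₁ kr | _       = ⊥-elim (clique⇒2K₁-free kr y)
    ... | inj₂ ir | inj₁ sl = inj₂ (oneTwo-cover cover (merge (0F ∷ 1F ∷ []) (2F ∷ []) ac sl ir))
    ... | inj₂ ir | inj₂ cl = inj₁ (monopolar-∪ cover cl ir)

    -- A clique that is also independent is a single vertex here, and can serve as the independent
    -- side of a monopolar partition. If `l` has an edge instead, 2K₃ in `r` would complete `R5`.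
    nearlySplit-clique : ∀ l r (ac : Across true ⟦ l ⟧ ⟦ r ⟧) → (∀ v → ⟦ node true l r ac ⟧ v) →
      K 1 ⊑ ⟦ l ⟧ → Clique ⟦ l ⟧ → MonopolarNearlySplit G
    nearlySplit-clique l r ac cover x kl with indep? l
    ... | inj₁ il with oneTwo-or-cluster x r ac
    ...   | inj₁ or = inj₂ (oneTwo-cover cover (merge (0F ∷ []) (0F ∷ 1F ∷ 2F ∷ []) ac kl or))
    ...   | inj₂ cr = inj₁ (monopolar-∪ (swap ∘ cover) cr il)
    nearlySplit-clique l r ac cover x kl
        | inj₂ e with oneTwo? r (λ d → free {H = R4} ¬R₄ (⊑-glue ac x d))
    ...   | inj₁ or = inj₂ (oneTwo-cover cover (merge (0F ∷ []) (0F ∷ 1F ∷ 2F ∷ []) ac kl or))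
    ...   | inj₂ f  = ⊥-elim (free {H = R5} ¬R₅ (⊑-glue ac e f))

    reachable-closed : ∀ {A B u v} → Across false A B → (∀ w → (A +ˢ B) w) → A u → Reachable G u v → A v
    reachable-closed ac cover p here = p
    reachable-closed ac cover p (step {v = w} a π) with cover w
    ... | inj₁ q = reachable-closed ac cover q π
    ... | inj₂ q = ⊥-elim (true≢false a (proj₂ (ac p q)))

    nearlySplit : ∀ t → (∀ v → ⟦ t ⟧ v) → MonopolarNearlySplit G
    nearlySplit ∅ cover = inj₂ (oneTwo-cover cover part-∅)
    nearlySplit (leaf v) cover = inj₂ (oneTwo-cover cover (part-leaf v))
    nearlySplit (node b l r ac) cover with inhabited? l | inhabited? r
    ... | inj₁ el | _ = nearlySplit r (λ v → [ (λ p → ⊥-elim (¬Fin0 (lab el p))) , id ] (cover v))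
    ... | inj₂ _ | inj₁ er = nearlySplit l (λ v → [ id , (λ p → ⊥-elim (¬Fin0 (lab er p))) ] (cover v))
    nearlySplit (node false l r ac) cover | inj₂ (emb (f , _) p) | inj₂ (emb (g , _) q) =
      -- A walk starting in `l` stays in `l`, so its end in `r` would lie on both sides.
      ⊥-elim (proj₁ (ac (reachable-closed ac cover (p 0F) (connected (f 0F) (g 0F))) (q 0F)) refl)
    nearlySplit (node true l r ac) cover | inj₂ x | inj₂ y with clique? l | clique? r
    ... | inj₁ kl | _ = nearlySplit-clique l r ac cover x kl
    ... | inj₂ _ | inj₁ kr = nearlySplit-clique r l (Across-sym ac) (swap ∘ cover) y kr
    ... | inj₂ m | inj₂ n
      with split? l (λ c → free {H = R1} ¬R₁ (⊑-glue ac c n))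
         | split? r (λ c → free {H = R1} ¬R₁ (⊑-glue (Across-sym ac) c m))
    ...   | inj₁ sl | inj₁ sr = inj₂ (oneTwo-cover cover (merge (0F ∷ 1F ∷ []) (0F ∷ 2F ∷ []) ac sl sr))
    ...   | inj₂ e  | _       = nearlySplit-2K₂ l r ac cover e n
    ...   | inj₁ _  | inj₂ e  = nearlySplit-2K₂ r l (Across-sym ac) (swap ∘ cover) e m

-- Heredity and exhaustive checks of the obstructions

-- Bounded search replaces the clique labels by P₃-freeness, since it ranges over vertex subsets only.
MonopolarSide : ∀ {m} → Graph m → Subset m → Set
MonopolarSide H A =
    (∀ u v → lookup A u ≡ false → lookup A v ≡ false → adj H u v ≡ false)
  × (∀ u v w → lookup A u ≡ true → lookup A v ≡ true → lookup A w ≡ true →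
      Adj H u v → Adj H v w → u ≡ w ⊎ Adj H u w)

monopolarSide? : ∀ {m} (H : Graph m) → Dec (∃ (MonopolarSide H))
monopolarSide? H = anySubset? λ A →
  (all? λ u → all? λ v → (lookup A u Bool.≟ false) →-dec (lookup A v Bool.≟ false) →-dec (adj H u v Bool.≟ false))
  ×-dec (all? λ u → all? λ v → all? λ w →
    (lookup A u Bool.≟ true) →-dec (lookup A v Bool.≟ true) →-dec (lookup A w Bool.≟ true) →-dec
    (adj H u v Bool.≟ true) →-dec (adj H v w Bool.≟ true) →-dec ((u ≟ w) ⊎-dec (adj H u w Bool.≟ true)))

-- `C` marks the clique; outside it, the two values of `I` name the two independent sets.
OneTwoSides : ∀ {m} → Graph m → Subset m → Subset m → Set
OneTwoSides H C I =
  ∀ u v → lookup C u ≡ false → lookup C v ≡ false → lookup I u ≡ lookup I v → adj H u v ≡ false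

OneTwoSubsets : ∀ {m} → Graph m → Set
OneTwoSubsets H = ∃ λ C →
  (∀ u v → lookup C u ≡ true → lookup C v ≡ true → u ≢ v → Adj H u v) × ∃ (OneTwoSides H C)

oneTwoSubsets? : ∀ {m} (H : Graph m) → Dec (OneTwoSubsets H)
oneTwoSubsets? H = anySubset? λ C →
  (all? λ u → all? λ v →
    (lookup C u Bool.≟ true) →-dec (lookup C v Bool.≟ true) →-dec ¬? (u ≟ v) →-dec (adj H u v Bool.≟ true))
  ×-dec (anySubset? λ I → all? λ u → all? λ v →
    (lookup C u Bool.≟ false) →-dec (lookup C v Bool.≟ false) →-dec
    (lookup I u Bool.≟ lookup I v) →-dec (adj H u v Bool.≟ false))

module _ {m n} {H : Graph m} {G : Graph n} where

  monopolar⇒side : InducedSub H G → Monopolar G → ∃ (MonopolarSide H)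
  monopolar⇒side (f , inj , pres) (side , c , clusters , independent) = tabulate (side ∘ f) ,
    (λ u v p q → trans (pres u v) (independent (f u) (f v) (at u p) (at v q))) ,
    transitive
    where
    at : ∀ u {b} → lookup (tabulate (side ∘ f)) u ≡ b → side (f u) ≡ b
    at u = trans (sym (lookup∘tabulate (side ∘ f) u))

    same-label : ∀ u v → side (f u) ≡ true → side (f v) ≡ true → Adj H u v → c (f u) ≡ c (f v)
    same-label u v p q a with f u ≟ f v
    ... | yes e = cong c e
    ... | no ne = proj₁ (clusters (f u) (f v) p q ne) (trans (sym (pres u v)) a)

    transitive : ∀ u v w → _ → _ → _ → Adj H u v → Adj H v w → u ≡ w ⊎ Adj H u w
    transitive u v w p q r a b with u ≟ w
    ... | yes e = inj₁ e
    ... | no ne = inj₂ (trans (pres u w) (proj₂ (clusters (f u) (f w) (at u p) (at w r) (ne ∘ inj))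
      (trans (same-label u v (at u p) (at v q) a) (same-label v w (at v q) (at w r) b))))

  oneTwo⇒subsets : InducedSub H G → OneTwoPartitionable G → OneTwoSubsets H
  oneTwo⇒subsets (f , inj , pres) (lab , clique , independent) =
    tabulate (is 0F ∘ lab ∘ f) ,
    (λ u v p q ne → trans (pres u v)
      (clique (f u) (f v) (is-true (at 0F u p)) (is-true (at 0F v q)) (ne ∘ inj))) ,
    tabulate (is 1F ∘ lab ∘ f) ,
    λ u v p q e → trans (pres u v) (independent (f u) (f v) (is-false (at 0F u p))
      (label-≡ _ _ (at 0F u p) (at 0F v q) (trans (at 1F u e) (lookup∘tabulate (is 1F ∘ lab ∘ f) v))))
    where
    is : Fin 3 → Fin 3 → Bool
    is i j = does (j ≟ i)

    at : ∀ i u {b} → lookup (tabulate (is i ∘ lab ∘ f)) u ≡ b → is i (lab (f u)) ≡ b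
    at i u = trans (sym (lookup∘tabulate (is i ∘ lab ∘ f) u))

    is-true : ∀ {j} → is 0F j ≡ true → j ≡ 0F
    is-true {0F} _ = refl

    is-false : ∀ {j} → is 0F j ≡ false → j ≢ 0F
    is-false () refl

    label-≡ : ∀ i j → is 0F i ≡ false → is 0F j ≡ false → is 1F i ≡ is 1F j → i ≡ j
    label-≡ 1F 1F _ _ _ = refl
    label-≡ 2F 2F _ _ _ = refl

-- Found by search here and in the next two checks. In all three graphs every clique misses some
-- triangle, so its complement is not bipartite.
R1-¬oneTwo : ¬ OneTwoSubsets R1
R1-¬oneTwo = from-no (oneTwoSubsets? R1)

2K₁⊕2K₂-¬oneTwo : ¬ OneTwoSubsets (2× K 1 ⊕ 2× K 2)
2K₁⊕2K₂-¬oneTwo = from-no (oneTwoSubsets? (2× K 1 ⊕ 2× K 2))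

2K₃-¬oneTwo : ¬ OneTwoSubsets (2× K 3)
2K₃-¬oneTwo = from-no (oneTwoSubsets? (2× K 3))

-- The search confirms, for `R1` to `R4`, that an independent set lies inside one factor of the join
-- and always leaves an induced P₃.
R1-¬monopolar : ¬ ∃ (MonopolarSide R1)
R1-¬monopolar = from-no (monopolarSide? R1)

R2-¬monopolar : ¬ ∃ (MonopolarSide R2)
R2-¬monopolar = from-no (monopolarSide? R2)

R3-¬monopolar : ¬ ∃ (MonopolarSide R3)
R3-¬monopolar = from-no (monopolarSide? R3)

R4-¬monopolar : ¬ ∃ (MonopolarSide R4)
R4-¬monopolar = from-no (monopolarSide? R4)

-- In `R5` to `R8` a dominating vertex in `A` sees `A`-vertices in two non-adjacent triangles,
-- giving P₃. In `R5` one of the two dominating vertices must lie in `A`; in the others, placing it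
-- in `B` leaves P₃ in `A`.
R5-¬monopolar : ¬ ∃ (MonopolarSide R5)
R5-¬monopolar = from-no (monopolarSide? R5)

R6-¬monopolar : ¬ ∃ (MonopolarSide R6)
R6-¬monopolar = from-no (monopolarSide? R6)

R7-¬monopolar : ¬ ∃ (MonopolarSide R7)
R7-¬monopolar = from-no (monopolarSide? R7)

R8-¬monopolar : ¬ ∃ (MonopolarSide R8)
R8-¬monopolar = from-no (monopolarSide? R8)

-- Testing a six-vertex `F` inside `H` keeps the nested search over two subsets small.
obstruction : ∀ {k m n} (F : Graph k) (H : Graph m) (G : Graph n) xs → {True (induces? F H xs)} →
  ¬ OneTwoSubsets F → ¬ ∃ (MonopolarSide H) → MonopolarNearlySplit G → ¬ InducedSub H G
obstruction F H G xs {t} ¬12 ¬M (inj₁ mono) e = ¬M (monopolar⇒side {H = H} {G} e mono)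
obstruction F H G xs {t} ¬12 ¬M (inj₂ part) e =
  ¬12 (oneTwo⇒subsets {H = F} {G} (InducedSub-trans {F = F} {H} {G} (induced {H = F} {H} xs {t}) e) part)

nearlySplit⇒free : ∀ {n} (G : Graph n) → MonopolarNearlySplit G →
    ¬ InducedSub R1 G × ¬ InducedSub R2 G × ¬ InducedSub R3 G × ¬ InducedSub R4 G
    × ¬ InducedSub R5 G × ¬ InducedSub R6 G × ¬ InducedSub R7 G × ¬ InducedSub R8 G
nearlySplit⇒free G s =
  obstruction R1 R1 G (0F ∷ 1F ∷ 2F ∷ 3F ∷ 4F ∷ 5F ∷ []) R1-¬oneTwo R1-¬monopolar s ,
  obstruction (2× K 1 ⊕ 2× K 2) R2 G (4F ∷ 6F ∷ 0F ∷ 1F ∷ 2F ∷ 3F ∷ []) 2K₁⊕2K₂-¬oneTwo R2-¬monopolar s ,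
  obstruction (2× K 1 ⊕ 2× K 2) R3 G (0F ∷ 1F ∷ 2F ∷ 3F ∷ 5F ∷ 6F ∷ []) 2K₁⊕2K₂-¬oneTwo R3-¬monopolar s ,
  obstruction (2× K 1 ⊕ 2× K 2) R4 G (1F ∷ 2F ∷ 3F ∷ 4F ∷ 5F ∷ 6F ∷ []) 2K₁⊕2K₂-¬oneTwo R4-¬monopolar s ,
  obstruction (2× K 3) R5 G (2F ∷ 3F ∷ 4F ∷ 5F ∷ 6F ∷ 7F ∷ []) 2K₃-¬oneTwo R5-¬monopolar s ,
  obstruction (2× K 3) R6 G (4F ∷ 5F ∷ 6F ∷ 7F ∷ 8F ∷ 9F ∷ []) 2K₃-¬oneTwo R6-¬monopolar s ,
  -- The second triangle lies in the diamond, and for `R8` in the paw.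
  obstruction (2× K 3) R7 G (1F ∷ 2F ∷ 3F ∷ 4F ∷ 5F ∷ 7F ∷ []) 2K₃-¬oneTwo R7-¬monopolar s ,
  obstruction (2× K 3) R8 G (1F ∷ 2F ∷ 3F ∷ 4F ∷ 6F ∷ 7F ∷ []) 2K₃-¬oneTwo R8-¬monopolar s

free⇒nearlySplit : ∀ {n} (G : Graph n) → Connected G → Cograph G →
    ¬ InducedSub R1 G × ¬ InducedSub R2 G × ¬ InducedSub R3 G × ¬ InducedSub R4 G
    × ¬ InducedSub R5 G × ¬ InducedSub R6 G × ¬ InducedSub R7 G × ¬ InducedSub R8 G →
    MonopolarNearlySplit G
free⇒nearlySplit G connected cograph (r₁ , r₂ , r₃ , r₄ , r₅ , r₆ , r₇ , r₈) =
  nearlySplit (proj₁ spanning) (proj₂ spanning)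
  where
  open VertexSets G
  open Structure connected r₁ r₂ r₃ r₄ r₅ r₆ r₇ r₈
  spanning = spanning-cotree cograph

theorem5 : ∀ (n : ℕ) (G : Graph n) → Connected G → Cograph G →
    (MonopolarNearlySplit G ⇔
    (¬ InducedSub R1 G × ¬ InducedSub R2 G × ¬ InducedSub R3 G × ¬ InducedSub R4 G
    × ¬ InducedSub R5 G × ¬ InducedSub R6 G × ¬ InducedSub R7 G × ¬ InducedSub R8 G))
theorem5 n G connected cograph = mk⇔ (nearlySplit⇒free G) (free⇒nearlySplit G connected cograph)
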